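{- For every theory $\Sigma$ and formula $A \Rightarrow B$: $\Sigma \vdash A \Rightarrow B$ if and only if there is a normalized derivation sequence of $A \Rightarrow B$ using formulas in $\Sigma$.
   Context: $Y$ is a non-empty finite set of attributes and $\mathcal{T}_Y = \{y^i \mid y \in Y, i \in \mathbb{Z}\}$; $M + j = \{y^{i+j} \mid y^i \in M\}$. A formula is $A \Rightarrow B$ with $A,B$ finite subsets of $\mathcal{T}_Y$. Deduction rules (for finite $A,B,C,D,E \subseteq \mathcal{T}_Y$, $i \in \mathbb{Z}$): (Ax) infer $A \cup B \Rightarrow A$; (Cut) from $A \Rightarrow B$ and $B \cup C \Rightarrow D$ infer $A \cup C \Rightarrow D$; (Shf) from $A \Rightarrow B$ infer $A+i \Rightarrow B+i$; also (Ref) infer $A \Rightarrow A$; (Acc) from $A \Rightarrow B \cup C$ and $C \Rightarrow D \cup E$ infer $A \Rightarrow B \cup C \cup D$; (Pro) from $A \Rightarrow B \cup C$ infer $A \Rightarrow B$. $\Sigma \vdash A \Rightarrow B$ means there is a finite sequence ending with $A \Rightarrow B$ each member of which is in $\Sigma$ or follows from earlier members by (Ax), (Cut) or (Shf). A normalized derivation sequence of $A \Rightarrow B$ using formulas in $\Sigma$ is a finite sequence of formulas which (1) starts with finitely many formulas in $\Sigma$; (2) continues by formulas obtained by (Shf) applied to formulas in part (1); (3) continues by $A \Rightarrow A$; (4) continues by formulas each obtained by (Acc) whose first hypothesis is the immediately preceding formula and whose second hypothesis is a formula from part (1) or (2); (5) terminates with $A \Rightarrow B$, obtained from the immediately preceding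 formula by (Pro). -}

module Defs where

open import Level using (Level; _⊔_; suc)
open import Data.Integer using (ℤ; _+_)
open import Data.List using (List; []; _∷_; _++_; _∷ʳ_; map; last)
open import Data.List.Membership.Propositional using (_∈_)
open import Data.List.Relation.Binary.BagAndSetEquality using (_∼[_]_; set)
open import Data.List.Relation.Unary.All using (All)
open import Data.List.Relation.Unary.Any using (Any)
open import Data.List.Relation.Unary.Linked using (Linked)
open import Data.Maybe using (just)
open import Data.Product using (_×_; _,_; ∃-syntax)
open import Relation.Binary.Core using (Rel)
open import Relation.Binary.PropositionalEquality using (_≡_)
open import Relation.Unary using (Pred)
open import Relation.Binary.Definitions using (_Respects_)

private
  variable
    a ℓ : Level

-- (y , i) is the attribute y annotated by the time point i, i.e. yⁱ.
𝒯 : Set a → Set a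
𝒯 Y = Y × ℤ

-- A finite set is given by an enumeration of its elements; order and
-- repetitions are irrelevant, so such sets are compared by _≋_, not by _≡_.
FinSubset : Set a → Set a
FinSubset Y = List (𝒯 Y)

infix 4 _≋_ _≈_
infixr 6 _∪_
infixl 7 _⊕_
infix 5 _⇒_

_≋_ : {Y : Set a} → Rel (FinSubset Y) a
A ≋ B = A ∼[ set ] B

_∪_ : {Y : Set a} → FinSubset Y → FinSubset Y → FinSubset Y
_∪_ = _++_

-- The translation M + j.
_⊕_ : {Y : Set a} → FinSubset Y → ℤ → FinSubset Y
M ⊕ j = map (λ (y , i) → y , i + j) M

record Formula (Y : Set a) : Set a where
  constructor _⇒_
  field
    antecedent consequent : FinSubset Y

_≈_ : {Y : Set a} → Rel (Formula Y) a
(A ⇒ B) ≈ (C ⇒ D) = (A ≋ C) × (B ≋ D)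

-- An arbitrary, possibly infinite, set of formulas. Being a set of formulas
-- rather than of their representations, it is closed under _≈_.
record Theory (Y : Set a) (ℓ : Level) : Set (a ⊔ suc ℓ) where
  field
    Member   : Pred (Formula Y) ℓ
    respects : Member Respects _≈_

open Theory public using (Member)

-- The deduction rules. The last argument is the inferred formula and those
-- before it are the hypotheses, in the order in which the rule lists them.

data Ax {Y : Set a} : Formula Y → Set a where
  ax : ∀ {χ} A B → χ ≈ (A ∪ B ⇒ A) → Ax χ

data Cut {Y : Set a} : Formula Y → Formula Y → Formula Y → Set a where
  cut : ∀ {φ ψ χ} A B C D →
        φ ≈ (A ⇒ B) → ψ ≈ (B ∪ C ⇒ D) → χ ≈ (A ∪ C ⇒ D) → Cut φ ψ χ

data Shf {Y : Set a} : Formula Y → Formula Y → Set a where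
  shf : ∀ {φ χ} A B (i : ℤ) →
        φ ≈ (A ⇒ B) → χ ≈ (A ⊕ i ⇒ B ⊕ i) → Shf φ χ

data Acc {Y : Set a} : Formula Y → Formula Y → Formula Y → Set a where
  acc : ∀ {φ ψ χ} A B C D E →
        φ ≈ (A ⇒ B ∪ C) → ψ ≈ (C ⇒ D ∪ E) → χ ≈ (A ⇒ B ∪ C ∪ D) → Acc φ ψ χ

data Pro {Y : Set a} : Formula Y → Formula Y → Set a where
  pro : ∀ {φ χ} A B C →
        φ ≈ (A ⇒ B ∪ C) → χ ≈ (A ⇒ B) → Pro φ χ

data Justified {Y : Set a} (Σ : Theory Y ℓ) (earlier : List (Formula Y))
               (χ : Formula Y) : Set (a ⊔ ℓ) where
  by-hyp : Member Σ χ → Justified Σ earlier χ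
  by-ax  : Ax χ → Justified Σ earlier χ
  by-cut : ∀ {φ ψ} → φ ∈ earlier → ψ ∈ earlier → Cut φ ψ χ → Justified Σ earlier χ
  by-shf : ∀ {φ} → φ ∈ earlier → Shf φ χ → Justified Σ earlier χ

data IsDerivation {Y : Set a} (Σ : Theory Y ℓ) : List (Formula Y) → Set (a ⊔ ℓ) where
  []   : IsDerivation Σ []
  snoc : ∀ {φs χ} → IsDerivation Σ φs → Justified Σ φs χ → IsDerivation Σ (φs ∷ʳ χ)

infix 3 _⊢_

_⊢_ : {Y : Set a} → Theory Y ℓ → Formula Y → Set (a ⊔ ℓ)
Σ ⊢ χ = ∃[ φs ] IsDerivation Σ (φs ∷ʳ χ)

record IsNormalizedDerivation {Y : Set a} (Σ : Theory Y ℓ) (A B : FinSubset Y)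
                              (φs : List (Formula Y)) : Set (a ⊔ ℓ) where
  field
    hyps shifts accs : List (Formula Y)
    sequence   : φs ≡ hyps ++ shifts ++ (A ⇒ A) ∷ accs ++ (A ⇒ B) ∷ []
    hyps-ok    : All (Member Σ) hyps
    shifts-ok  : All (λ χ → Any (λ φ → Shf φ χ) hyps) shifts
    accs-ok    : Linked (λ φ χ → Any (λ ψ → Acc φ ψ χ) (hyps ++ shifts)) ((A ⇒ A) ∷ accs)
    penultimate    : Formula Y
    penultimate-ok : last ((A ⇒ A) ∷ accs) ≡ just penultimate
    final-ok       : Pro penultimate (A ⇒ B)

{-# OPTIONS --safe #-}
-- The antecedent A is only ever used to grow a set M ⊇ A: whenever Σ contains
-- C ⇒ D and C + i ⊆ M, replace M by M ∪ (D + i). The sets B contained in some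
-- set grown from A are closed under (Ax), (Cut) and (Shf), because growth is
-- monotone, transitive and commutes with translation; and a growth process,
-- read step by step, is exactly the (Acc) part of a normalized derivation.
-- Conversely, (Acc) and (Pro) are derivable from (Ax) and (Cut).
module Submission where

open import Defs
open import Data.Fin using (Fin)
open import Data.Integer using (ℤ; _+_; 0ℤ)
open import Data.Integer.Properties using (+-assoc; +-identityʳ)
open import Data.List using (List; []; _∷_; _++_; _∷ʳ_; last)
open import Data.List.Membership.Propositional.Properties using (∈-++⁺ˡ; ∈-++⁺ʳ; ∈-++⁻)
open import Data.List.Properties using (++-assoc; ++-identityʳ; map-++; map-∘; map-cong; map-id)
open import Data.List.Relation.Binary.Subset.Propositional using (_⊆_)
open import Data.List.Relation.Binary.Subset.Propositional.Properties
  using (⊆-refl; ⊆-reflexive; xs⊆xs++ys; xs⊆ys++xs; ++⁺ʳ; ++⁺ˡ; ++⁺; map⁺; Any-resp-⊆)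
open import Data.List.Relation.Unary.All as All using (All; []; _∷_)
import Data.List.Relation.Unary.All.Properties as All
open import Data.List.Relation.Unary.Any using (Any; here; there)
import Data.List.Relation.Unary.Any.Properties as Any
open import Data.List.Relation.Unary.Linked as Linked using (Linked; [-]; _∷_)
open import Data.Maybe using (just)
import Data.Maybe.Relation.Unary.All as Maybe
open import Data.Nat using (ℕ; NonZero)
open import Data.Product using (_×_; _,_; ∃-syntax; proj₂)
open import Data.Sum using ([_,_]′)
open import Function using (_∘_)
open import Function.Bundles using (_↔_; _⇔_; mk⇔; module Equivalence)
open import Level using (Level; _⊔_)
open import Relation.Binary.Construct.Closure.ReflexiveTransitive
  using (Star; ε; _◅_; _◅◅_; gmap)
open import Relation.Binary.PropositionalEquality
  using (_≡_; refl; sym; trans; cong; subst)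

private
  variable
    a ℓ : Level
    Y : Set a
    A B C D M N : FinSubset Y
    φ ψ χ : Formula Y

≋⇒⊆ : A ≋ B → A ⊆ B
≋⇒⊆ A≋B = Equivalence.to A≋B

≋⇒⊇ : A ≋ B → B ⊆ A
≋⇒⊇ A≋B = Equivalence.from A≋B

⊆-antisym : A ⊆ B → B ⊆ A → A ≋ B
⊆-antisym A⊆B B⊆A = mk⇔ A⊆B B⊆A

≋-refl : A ≋ A
≋-refl = ⊆-antisym ⊆-refl ⊆-refl

≈-refl : φ ≈ φ
≈-refl = ≋-refl , ≋-refl

∪-least : A ⊆ M → B ⊆ M → A ∪ B ⊆ M
∪-least {A = A} A⊆M B⊆M = [ A⊆M , B⊆M ]′ ∘ ∈-++⁻ A

∪-absorbʳ : B ⊆ A → A ≋ A ∪ B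
∪-absorbʳ B⊆A = ⊆-antisym (xs⊆xs++ys _ _) (∪-least ⊆-refl B⊆A)

∪-absorbˡ : B ⊆ A → A ≋ B ∪ A
∪-absorbˡ B⊆A = ⊆-antisym (xs⊆ys++xs _ _) (∪-least B⊆A ⊆-refl)

⊕-identityʳ : (A : FinSubset Y) → A ⊕ 0ℤ ≡ A
⊕-identityʳ A = trans (map-cong (λ (y , i) → cong (y ,_) (+-identityʳ i)) A) (map-id A)

⊕-⊕ : (A : FinSubset Y) (i j : ℤ) → A ⊕ i ⊕ j ≡ A ⊕ (i + j)
⊕-⊕ A i j = trans (sym (map-∘ A)) (map-cong (λ (y , k) → cong (y ,_) (+-assoc k i j)) A)

module _ {Y : Set a} (Σ : Theory Y ℓ) where

  -- (Cut) has two hypotheses, each with its own derivation, and concatenation puts both into one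
  -- sequence. References inside the second part are moved past the first.
  IsDerivation-++ : ∀ {φs ψs} → IsDerivation Σ φs → IsDerivation Σ ψs → IsDerivation Σ (φs ++ ψs)
  IsDerivation-++ {φs} d [] = subst (IsDerivation Σ) (sym (++-identityʳ φs)) d
  IsDerivation-++ {φs} d (snoc {ψs} {χ} e j) =
    subst (IsDerivation Σ) (++-assoc φs ψs (χ ∷ [])) (snoc (IsDerivation-++ d e) (weaken j))
    where
    weaken : Justified Σ ψs χ → Justified Σ (φs ++ ψs) χ
    weaken (by-hyp m)     = by-hyp m
    weaken (by-ax r)      = by-ax r
    weaken (by-cut p q r) = by-cut (∈-++⁺ʳ φs p) (∈-++⁺ʳ φs q) r
    weaken (by-shf p r)   = by-shf (∈-++⁺ʳ φs p) r

  ⊢-hyp : Member Σ χ → Σ ⊢ χ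
  ⊢-hyp m = [] , snoc [] (by-hyp m)

  ⊢-Ax : Ax χ → Σ ⊢ χ
  ⊢-Ax r = [] , snoc [] (by-ax r)

  ⊢-Shf : Shf φ χ → Σ ⊢ φ → Σ ⊢ χ
  ⊢-Shf r (φs , d) = _ , snoc d (by-shf (∈-++⁺ʳ φs (here refl)) r)

  ⊢-Cut : Cut φ ψ χ → Σ ⊢ φ → Σ ⊢ ψ → Σ ⊢ χ
  ⊢-Cut {φ = φ} r (φs , d) (ψs , e) = _ ,
    snoc (IsDerivation-++ d e)
      (by-cut (∈-++⁺ˡ (∈-++⁺ʳ φs (here refl))) (∈-++⁺ʳ (φs ∷ʳ φ) (∈-++⁺ʳ ψs (here refl))) r)

  ⊢-⊇ : B ⊆ A → Σ ⊢ A ⇒ B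
  ⊢-⊇ {B = B} {A = A} B⊆A = ⊢-Ax (ax B A (∪-absorbˡ B⊆A , ≋-refl))

  -- This is (Cut) with an empty side set. Combined with `⊢-⊇` it also exchanges a set for another
  -- enumeration of it.
  ⊢-trans : Σ ⊢ A ⇒ B → Σ ⊢ B ⇒ C → Σ ⊢ A ⇒ C
  ⊢-trans {A = A} {B = B} {C = C} =
    ⊢-Cut (cut A B [] C ≈-refl (∪-absorbʳ (λ ()) , ≋-refl) (∪-absorbʳ (λ ()) , ≋-refl))

  -- (Cut) with `A` itself as the side set: `B ∪ A ⇒ A ∪ B` comes from (Ax), and the resulting
  -- antecedent `A ∪ A` collapses to `A`.
  ⊢-∪ : Σ ⊢ A ⇒ B → Σ ⊢ A ⇒ A ∪ B
  ⊢-∪ {A = A} {B = B} A⊢B =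
    ⊢-Cut (cut A B A (A ∪ B) ≈-refl ≈-refl (∪-absorbʳ ⊆-refl , ≋-refl))
      A⊢B (⊢-⊇ (∪-least (xs⊆ys++xs A B) (xs⊆xs++ys B A)))

  ⊢-Pro : Pro φ χ → Σ ⊢ φ → Σ ⊢ χ
  ⊢-Pro (pro A B C (A₁≋ , B₁≋) (A₂≋ , B₂≋)) ⊢φ =
    ⊢-trans (⊢-⊇ (≋⇒⊇ A₂≋ ∘ ≋⇒⊆ A₁≋))
      (⊢-trans ⊢φ (⊢-⊇ (≋⇒⊇ B₁≋ ∘ xs⊆xs++ys B C ∘ ≋⇒⊆ B₂≋)))

  ⊢-Acc : Acc φ ψ χ → Σ ⊢ φ → Σ ⊢ ψ → Σ ⊢ χ
  ⊢-Acc (acc A B C D E (A₁≋ , B₁≋) (A₂≋ , B₂≋) (A₃≋ , B₃≋)) ⊢φ ⊢ψ =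
    ⊢-trans (⊢-⊇ (≋⇒⊇ A₃≋ ∘ ≋⇒⊆ A₁≋))
      (⊢-trans ⊢φ
        -- Passing to `C` alone would lose `B`, so `⊢-∪` keeps all of `B ∪ C` beside the consequent
        -- of `ψ`.
        (⊢-trans (⊢-∪ (⊢-trans (⊢-⊇ (≋⇒⊇ B₁≋ ∘ xs⊆ys++xs C B ∘ ≋⇒⊆ A₂≋)) ⊢ψ))
          (⊢-⊇ (++⁺ (≋⇒⊇ B₁≋) (≋⇒⊇ B₂≋ ∘ xs⊆xs++ys D E)
                 ∘ ⊆-reflexive (sym (++-assoc B C D)) ∘ ≋⇒⊆ B₃≋))))

  normalized⇒⊢ : ∀ {φs} → IsNormalizedDerivation Σ A B φs → Σ ⊢ A ⇒ B
  normalized⇒⊢ {A = A} n = ⊢-Pro final-ok ⊢penultimate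
    where
    open IsNormalizedDerivation n

    ⊢hyps : All (Σ ⊢_) hyps
    ⊢hyps = All.map ⊢-hyp hyps-ok

    ⊢shifts : All (Σ ⊢_) shifts
    ⊢shifts = All.map (All.lookupWith (λ ⊢φ r → ⊢-Shf r ⊢φ) ⊢hyps) shifts-ok

    ⊢linked : ∀ {φ φs} → Σ ⊢ φ →
              Linked (λ φ χ → Any (λ ψ → Acc φ ψ χ) (hyps ++ shifts)) (φ ∷ φs) →
              All (Σ ⊢_) (φ ∷ φs)
    ⊢linked ⊢φ [-]       = ⊢φ ∷ []
    ⊢linked ⊢φ (ψ∈ ∷ rs) =
      ⊢φ ∷ ⊢linked (All.lookupWith (λ ⊢ψ r → ⊢-Acc r ⊢φ ⊢ψ) (All.++⁺ ⊢hyps ⊢shifts) ψ∈) rs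

    ⊢penultimate : Σ ⊢ penultimate
    ⊢penultimate = Maybe.drop-just
      (subst (Maybe.All (Σ ⊢_)) penultimate-ok (All.last⁺ (⊢linked (⊢-⊇ ⊆-refl) accs-ok)))

  -- One (Acc) step, seen on the consequent alone.
  data _↝_ (M : FinSubset Y) : FinSubset Y → Set (a ⊔ ℓ) where
    grow : ∀ i → Member Σ (C ⇒ D) → C ⊕ i ⊆ M → M ↝ (M ∪ D ⊕ i)

  _↝*_ : FinSubset Y → FinSubset Y → Set (a ⊔ ℓ)
  _↝*_ = Star _↝_

  ↝*⇒⊆ : M ↝* N → M ⊆ N
  ↝*⇒⊆ ε                  = ⊆-refl
  ↝*⇒⊆ (grow i m C⊆ ◅ gs) = ↝*⇒⊆ gs ∘ xs⊆xs++ys _ _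

  -- Every step stays applicable in a larger set, so the same steps are replayed from `A`.
  ↝*-mono : M ⊆ A → M ↝* N → ∃[ B ] ((A ↝* B) × N ⊆ B)
  ↝*-mono M⊆A ε = _ , ε , M⊆A
  ↝*-mono M⊆A (grow i m C⊆ ◅ gs) =
    let B , gs′ , N⊆B = ↝*-mono (++⁺ˡ _ M⊆A) gs
    in B , grow i m (M⊆A ∘ C⊆) ◅ gs′ , N⊆B

  -- The translated step uses the same formula of `Σ`, with shift `i + j` in place of `i`.
  ↝-⊕ : ∀ j → M ↝ N → (M ⊕ j) ↝ (N ⊕ j)
  ↝-⊕ {M = M} j (grow {C} {D} i m C⊆) =
    subst ((M ⊕ j) ↝_)
      (sym (trans (map-++ _ M (D ⊕ i)) (cong (M ⊕ j ∪_) (⊕-⊕ D i j))))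
      (grow (i + j) m (map⁺ _ C⊆ ∘ ⊆-reflexive (sym (⊕-⊕ C i j))))

  -- Asking for `B ⊆ M` rather than equality leaves room for the final (Pro) and makes the choice of
  -- enumeration irrelevant.
  Reachable : Formula Y → Set (a ⊔ ℓ)
  Reachable (A ⇒ B) = ∃[ M ] ((A ↝* M) × B ⊆ M)

  reachable-hyp : Member Σ χ → Reachable χ
  reachable-hyp {A ⇒ B} m =
    _ , grow 0ℤ m (⊆-reflexive (⊕-identityʳ A)) ◅ ε ,
    xs⊆ys++xs _ A ∘ ⊆-reflexive (sym (⊕-identityʳ B))

  reachable-⊆ : ∀ {A A′ B B′} → A ⊆ A′ → B′ ⊆ B → Reachable (A ⇒ B) → Reachable (A′ ⇒ B′)
  reachable-⊆ A⊆A′ B′⊆B (M , gs , B⊆M) =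
    let N , gs′ , M⊆N = ↝*-mono A⊆A′ gs in N , gs′ , M⊆N ∘ B⊆M ∘ B′⊆B

  reachable-Ax : Ax χ → Reachable χ
  reachable-Ax (ax A B (A₁≋ , B₁≋)) = _ , ε , ≋⇒⊇ A₁≋ ∘ xs⊆xs++ys A B ∘ ≋⇒⊆ B₁≋

  reachable-Shf : Shf φ χ → Reachable φ → Reachable χ
  reachable-Shf (shf A B i (A₁≋ , B₁≋) (A₂≋ , B₂≋)) (M , gs , B₁⊆M) =
    reachable-⊆ (≋⇒⊇ A₂≋ ∘ map⁺ _ (≋⇒⊆ A₁≋)) (map⁺ _ (≋⇒⊇ B₁≋) ∘ ≋⇒⊆ B₂≋)
      (M ⊕ i , gmap (_⊕ i) (↝-⊕ i) gs , map⁺ _ B₁⊆M)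

  -- The set `M` grown from `A` contains both `B` and `A`, so the second growth can be replayed from
  -- `M` and appended to the first.
  reachable-trans : Reachable (A ⇒ B) → Reachable (B ∪ A ⇒ D) → Reachable (A ⇒ D)
  reachable-trans (M , gs , B⊆M) rD =
    let N , hs , D⊆N = reachable-⊆ (∪-least B⊆M (↝*⇒⊆ gs)) ⊆-refl rD in N , gs ◅◅ hs , D⊆N

  reachable-Cut : Cut φ ψ χ → Reachable φ → Reachable ψ → Reachable χ
  reachable-Cut (cut A B C D (A₁≋ , B₁≋) (A₂≋ , B₂≋) (A₃≋ , B₃≋)) rφ rψ =
    reachable-trans
      -- Both hypotheses are brought to the antecedent of `χ`, which represents `A ∪ C`: it replaces
      -- `A` in the first and `C` in the second.
      (reachable-⊆ (≋⇒⊇ A₃≋ ∘ xs⊆xs++ys A C ∘ ≋⇒⊆ A₁≋) (≋⇒⊇ B₁≋) rφ)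
      (reachable-⊆ (++⁺ʳ B (≋⇒⊇ A₃≋ ∘ xs⊆ys++xs C A) ∘ ≋⇒⊆ A₂≋) (≋⇒⊇ B₂≋ ∘ ≋⇒⊆ B₃≋) rψ)

  reachable-justified : ∀ {φs} → All Reachable φs → Justified Σ φs χ → Reachable χ
  reachable-justified rs (by-hyp m)     = reachable-hyp m
  reachable-justified rs (by-ax r)      = reachable-Ax r
  reachable-justified rs (by-cut p q r) = reachable-Cut r (All.lookup rs p) (All.lookup rs q)
  reachable-justified rs (by-shf p r)   = reachable-Shf r (All.lookup rs p)

  reachable-all : ∀ {φs} → IsDerivation Σ φs → All Reachable φs
  reachable-all []         = []
  reachable-all (snoc d j) = All.++⁺ (reachable-all d) (reachable-justified (reachable-all d) j ∷ [])

  ⊢⇒reachable : Σ ⊢ χ → Reachable χ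
  ⊢⇒reachable (φs , d) = All.lookup (reachable-all d) (∈-++⁺ʳ φs (here refl))

  -- Parts (1), (2) and (4) of a normalized derivation, but starting at `A ⇒ M` for arbitrary `M`,
  -- since the induction on the growth removes its first step and thereby changes the starting set.
  record AccChain (A M N : FinSubset Y) : Set (a ⊔ ℓ) where
    field
      hyps shifts accs : List (Formula Y)
      hyps-ok   : All (Member Σ) hyps
      shifts-ok : All (λ χ → Any (λ φ → Shf φ χ) hyps) shifts
      accs-ok   : Linked (λ φ χ → Any (λ ψ → Acc φ ψ χ) (hyps ++ shifts)) ((A ⇒ M) ∷ accs)
      last-acc  : last ((A ⇒ M) ∷ accs) ≡ just (A ⇒ N)

  accChain : M ↝* N → AccChain A M N
  accChain ε = record
    { hyps = [] ; shifts = [] ; accs = []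
    ; hyps-ok = [] ; shifts-ok = [] ; accs-ok = [-] ; last-acc = refl }
  accChain {M = M} {A = A} (grow {C} {D} i m C⊆M ◅ gs) = record
    { hyps      = (C ⇒ D) ∷ hyps
    ; shifts    = (C ⊕ i ⇒ D ⊕ i) ∷ shifts
    ; accs      = (A ⇒ M ∪ D ⊕ i) ∷ accs
    ; hyps-ok   = m ∷ hyps-ok
    ; shifts-ok = here (shf C D i ≈-refl ≈-refl) ∷ All.map there shifts-ok
    ; accs-ok   = there (Any.++⁺ʳ hyps (here step)) ∷ Linked.map weaken accs-ok
    ; last-acc  = last-acc
    }
    where
    open AccChain (accChain {A = A} gs)

    step : Acc (A ⇒ M) (C ⊕ i ⇒ D ⊕ i) (A ⇒ M ∪ D ⊕ i)
    -- `C ⊕ i` already lies in `M`, so `M` represents `M ∪ C ⊕ i` as (Acc) requires; the whole of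
    -- `D ⊕ i` is added, leaving `E` empty.
    step = acc A M (C ⊕ i) (D ⊕ i) []
      (≋-refl , ∪-absorbʳ C⊆M)
      (≋-refl , ∪-absorbʳ (λ ()))
      (≋-refl , ⊆-antisym
        (++⁺ʳ M (xs⊆ys++xs (D ⊕ i) (C ⊕ i)))
        (∪-least (xs⊆xs++ys M (D ⊕ i)) (++⁺ˡ (D ⊕ i) C⊆M)))

    weaken : ∀ {φ χ} → Any (λ ψ → Acc φ ψ χ) (hyps ++ shifts) →
             Any (λ ψ → Acc φ ψ χ) (((C ⇒ D) ∷ hyps) ++ (C ⊕ i ⇒ D ⊕ i) ∷ shifts)
    weaken = Any-resp-⊆ (there ∘ ++⁺ʳ hyps there)

  reachable⇒normalized : Reachable (A ⇒ B) → ∃[ φs ] IsNormalizedDerivation Σ A B φs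
  reachable⇒normalized {A = A} {B = B} (M , gs , B⊆M) = _ , record
    { hyps = hyps ; shifts = shifts ; accs = accs
    ; sequence       = refl
    ; hyps-ok        = hyps-ok
    ; shifts-ok      = shifts-ok
    ; accs-ok        = accs-ok
    ; penultimate    = A ⇒ M
    ; penultimate-ok = last-acc
    -- As `B ⊆ M`, the set `M` is also `B ∪ M`, from which (Pro) drops the second part.
    ; final-ok       = pro A B M (≋-refl , ∪-absorbˡ B⊆M) ≈-refl
    }
    where open AccChain (accChain {A = A} gs)

theorem10 : ∀ {a ℓ : Level} (Y : Set a) (n : ℕ) .{{_ : NonZero n}} → Y ↔ Fin n →
    (Σ : Theory Y ℓ) (A B : FinSubset Y) →
    (Σ ⊢ A ⇒ B) ⇔ (∃[ φs ] IsNormalizedDerivation Σ A B φs)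
theorem10 Y n Y↔Fin Σ A B =
  mk⇔ (reachable⇒normalized Σ ∘ ⊢⇒reachable Σ) (normalized⇒⊢ Σ ∘ proj₂)
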